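{- Let $G$ be a finite abelian group of exponent $e$. Suppose there exists a set $\{d_i\}_{i=1}^n$ of pairwise relatively prime positive integers such that \[\sum_{i=1}^{n} \frac{1}{d_i}+\frac{1}{\prod_{i=1}^{n} d_i} =1\] and $e$ divides $\prod_{i=1}^{n} d_i$. Then there is an arithmetical structure on a star graph (that is, on $S_m$ for some $m$) whose critical group is isomorphic to $G$.
   Context: The exponent of a finite abelian group $\bigoplus_{k=1}^t \mathbb{Z}/m_k\mathbb{Z}$ is $\operatorname{lcm}(m_1,\dotsc,m_t)$. An arithmetical structure on a finite, connected, loopless graph $H$ with vertex set $V(H)$ is a pair $(\mathbf{d},\mathbf{r})$, where $\mathbf{r}=(r_v)_{v\in V(H)}$ consists of positive integers with no common factor, $\mathbf{d}=(d_v)_{v\in V(H)}$ consists of nonnegative integers, and for every vertex $v$ we have $r_vd_v=\sum r_u$, the sum being over all $u$ adjacent to $v$ (with multiplicity for multigraphs). Its critical group is the torsion part of the cokernel (over $\mathbb{Z}$) of the matrix $\operatorname{diag}(\mathbf{d})-A(H)$, where $A(H)$ is the adjacency matrix of $H$. The star graph $S_m$ has $m$ leaves, each joined by one edge to a central vertex (and no other edges). -}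

module Defs where

open import Level using (Level; 0ℓ; _⊔_)
open import Algebra.Bundles using (AbelianGroup)
import Algebra.Construct.Pointwise as Pointwise
import Algebra.Properties.AbelianGroup as AbelianGroupProperties
import Algebra.Properties.CommutativeMonoid.Mult as Mult
import Algebra.Properties.CommutativeSemigroup as CommutativeSemigroupProperties
import Algebra.Properties.Monoid.Sum as Sum
open import Algebra.Morphism.Structures using (module GroupMorphisms)
open import Data.Bool.Base using (if_then_else_)
open import Data.Fin.Base using (Fin; zero; suc)
open import Data.Fin.Properties using (_≟_)
open import Data.Integer.Base as ℤ using (ℤ; +_; 0ℤ)
import Data.Integer.Divisibility.Signed as ℤ
import Data.Integer.Properties as ℤ
open import Data.Nat.Base as ℕ using (ℕ; NonZero; _*_)
open import Data.Nat.Divisibility using (_∣_)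
open import Data.Nat.LCM using (lcm)
import Data.Nat.Properties as ℕ
open import Data.Product.Base using (Σ; Σ-syntax; ∃-syntax; _×_; _,_; proj₁; map₂)
import Data.Rational.Properties as ℚ
open import Data.Vec.Functional using (Vector; foldr; head; tail)
open import Function.Base using (_on_)
open import Relation.Binary.Construct.Closure.ReflexiveTransitive
  using (Star; _◅_) renaming (ε to stop)
open import Relation.Binary.PropositionalEquality.Core
  using (_≡_; _≢_; refl; cong; cong₂; trans; sym)
import Relation.Binary.Reasoning.Setoid as SetoidReasoning
open import Relation.Nullary.Decidable.Core using (does)
open import Relation.Unary using (Pred)

private
  variable
    a b c ℓ ℓ₁ ℓ₂ p : Level
    m n : ℕ

open Sum ℕ.+-0-monoid public using () renaming (sum to sumℕ)
open Sum ℕ.*-1-monoid public using () renaming (sum to productℕ)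
open Sum ℚ.+-0-monoid public using () renaming (sum to sumℚ)
private
  module ℤΣ where
    open import Algebra.Properties.Semiring.Sum ℤ.+-*-semiring public
open ℤΣ public using () renaming (sum to sumℤ)

productℕ-nonZero : (d : Vector ℕ n) → (∀ i → NonZero (d i)) → NonZero (productℕ d)
productℕ-nonZero {ℕ.zero}  d d≢0 = _
productℕ-nonZero {ℕ.suc n} d d≢0 =
  ℕ.m*n≢0 (head d) (productℕ (tail d))
    {{d≢0 zero}} {{productℕ-nonZero (tail d) (λ i → d≢0 (suc i))}}

infix 4 _≅_

_≅_ : AbelianGroup a ℓ₁ → AbelianGroup b ℓ₂ → Set (a ⊔ b ⊔ ℓ₁ ⊔ ℓ₂)
G ≅ H = Σ[ f ∈ (G.Carrier → H.Carrier) ] IsGroupIsomorphism f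
  where
  module G = AbelianGroup G
  module H = AbelianGroup H
  open GroupMorphisms G.rawGroup H.rawGroup using (IsGroupIsomorphism)

module _ (G : AbelianGroup c ℓ) where
  open AbelianGroup G renaming (refl to ≈-refl; sym to ≈-sym; trans to ≈-trans)
  open AbelianGroupProperties G using (⁻¹-∙-comm; ⁻¹-involutive; ε⁻¹≈ε)
  open CommutativeSemigroupProperties commutativeSemigroup using (interchange)
  open SetoidReasoning setoid

  record IsSubgroup (N : Pred Carrier p) : Set (c ⊔ ℓ ⊔ p) where
    field
      resp      : ∀ {x y} → x ≈ y → N x → N y
      ε-closed  : N ε
      ∙-closed  : ∀ {x y} → N x → N y → N (x ∙ y)
      ⁻¹-closed : ∀ {x} → N x → N (x ⁻¹)

  -- The quotient keeps the carrier of G and coarsens its equality.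
  quotient : {N : Pred Carrier p} → IsSubgroup N → AbelianGroup c p
  quotient {N = N} isSubgroup = record
    { Carrier = Carrier
    ; _≈_     = _∼_
    ; _∙_     = _∙_
    ; ε       = ε
    ; _⁻¹     = _⁻¹
    ; isAbelianGroup = record
      { isGroup = record
        { isMonoid = record
          { isSemigroup = record
            { isMagma = record
              { isEquivalence = record
                { refl  = ≈⇒∼ ≈-refl
                ; sym   = λ {x} {y} x∼y → resp (flip-lemma x y) (⁻¹-closed x∼y)
                ; trans = λ {x} {y} {z} x∼y y∼z →
                    resp (trans-lemma x y z) (∙-closed x∼y y∼z)
                }
              ; ∙-cong = λ {x} {y} {u} {v} x∼y u∼v →
                  resp (cong-lemma x y u v) (∙-closed x∼y u∼v)
              }
            ; assoc = λ x y z → ≈⇒∼ (assoc x y z)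
            }
          ; identity = (λ x → ≈⇒∼ (identityˡ x)) , (λ x → ≈⇒∼ (identityʳ x))
          }
        ; inverse = (λ x → ≈⇒∼ (inverseˡ x)) , (λ x → ≈⇒∼ (inverseʳ x))
        ; ⁻¹-cong = λ {x} {y} x∼y →
            resp (≈-sym (⁻¹-∙-comm x (y ⁻¹))) (⁻¹-closed x∼y)
        }
      ; comm = λ x y → ≈⇒∼ (comm x y)
      }
    }
    where
    open IsSubgroup isSubgroup

    _∼_ : Carrier → Carrier → Set _
    x ∼ y = N (x ∙ y ⁻¹)

    ≈⇒∼ : ∀ {x y} → x ≈ y → x ∼ y
    ≈⇒∼ {x} {y} x≈y =
      resp (≈-trans (≈-sym (inverseʳ y)) (∙-congʳ (≈-sym x≈y))) ε-closed

    flip-lemma : ∀ x y → (x ∙ y ⁻¹) ⁻¹ ≈ y ∙ x ⁻¹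
    flip-lemma x y = begin
      (x ∙ y ⁻¹) ⁻¹     ≈⟨ ⁻¹-∙-comm x (y ⁻¹) ⟨
      x ⁻¹ ∙ y ⁻¹ ⁻¹    ≈⟨ ∙-congˡ (⁻¹-involutive y) ⟩
      x ⁻¹ ∙ y          ≈⟨ comm _ _ ⟩
      y ∙ x ⁻¹          ∎

    trans-lemma : ∀ x y z → (x ∙ y ⁻¹) ∙ (y ∙ z ⁻¹) ≈ x ∙ z ⁻¹
    trans-lemma x y z = begin
      (x ∙ y ⁻¹) ∙ (y ∙ z ⁻¹)  ≈⟨ assoc x _ _ ⟩
      x ∙ (y ⁻¹ ∙ (y ∙ z ⁻¹))  ≈⟨ ∙-congˡ (assoc _ y _) ⟨
      x ∙ ((y ⁻¹ ∙ y) ∙ z ⁻¹)  ≈⟨ ∙-congˡ (∙-congʳ (inverseˡ y)) ⟩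
      x ∙ (ε ∙ z ⁻¹)           ≈⟨ ∙-congˡ (identityˡ _) ⟩
      x ∙ z ⁻¹                 ∎

    cong-lemma : ∀ x y u v → (x ∙ y ⁻¹) ∙ (u ∙ v ⁻¹) ≈ (x ∙ u) ∙ (y ∙ v) ⁻¹
    cong-lemma x y u v =
      ≈-trans (interchange x (y ⁻¹) u (v ⁻¹)) (∙-congˡ (⁻¹-∙-comm y v))

  subgroup : {N : Pred Carrier p} → IsSubgroup N → AbelianGroup (c ⊔ p) ℓ
  subgroup {N = N} isSubgroup = record
    { Carrier = Σ Carrier N
    ; _≈_     = _≈_ on proj₁
    ; _∙_     = λ (x , Nx) (y , Ny) → x ∙ y , ∙-closed Nx Ny
    ; ε       = ε , ε-closed
    ; _⁻¹     = λ (x , Nx) → x ⁻¹ , ⁻¹-closed Nx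
    ; isAbelianGroup = record
      { isGroup = record
        { isMonoid = record
          { isSemigroup = record
            { isMagma = record
              { isEquivalence = record
                { refl = ≈-refl ; sym = ≈-sym ; trans = ≈-trans }
              ; ∙-cong = ∙-cong
              }
            ; assoc = λ _ _ _ → assoc _ _ _
            }
          ; identity = (λ _ → identityˡ _) , (λ _ → identityʳ _)
          }
        ; inverse = (λ _ → inverseˡ _) , (λ _ → inverseʳ _)
        ; ⁻¹-cong = ⁻¹-cong
        }
      ; comm = λ _ _ → comm _ _
      }
    }
    where open IsSubgroup isSubgroup

  open Mult commutativeMonoid
    using (×-congʳ; ×-congˡ; ×-assocˡ; ×-distrib-+) renaming (_×_ to _·_)

  IsTorsion : Pred Carrier ℓ
  IsTorsion x = ∃[ k ] NonZero k × k · x ≈ ε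

  private
    ·-ε : ∀ k → k · ε ≈ ε
    ·-ε ℕ.zero    = ≈-refl
    ·-ε (ℕ.suc k) = ≈-trans (identityˡ _) (·-ε k)

    ·-⁻¹ : ∀ k x → k · (x ⁻¹) ≈ (k · x) ⁻¹
    ·-⁻¹ ℕ.zero    x = ≈-sym ε⁻¹≈ε
    ·-⁻¹ (ℕ.suc k) x = ≈-trans (∙-congˡ (·-⁻¹ k x)) (⁻¹-∙-comm x (k · x))

    ·-annihilate : ∀ k {l x} → l · x ≈ ε → (k * l) · x ≈ ε
    ·-annihilate k {l} {x} lx≈ε = begin
      (k * l) · x  ≈⟨ ×-assocˡ x k l ⟨
      k · (l · x)  ≈⟨ ×-congʳ k lx≈ε ⟩
      k · ε        ≈⟨ ·-ε k ⟩
      ε            ∎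

  isTorsion-isSubgroup : IsSubgroup IsTorsion
  isTorsion-isSubgroup = record
    { resp      = λ x≈y (k , k≢0 , kx≈ε) →
        k , k≢0 , ≈-trans (×-congʳ k (≈-sym x≈y)) kx≈ε
    ; ε-closed  = 1 , _ , ·-ε 1
    ; ∙-closed  = λ {x} {y} (k , k≢0 , kx≈ε) (l , l≢0 , ly≈ε) →
        k * l , ℕ.m*n≢0 k l {{k≢0}} {{l≢0}} , (begin
          (k * l) · (x ∙ y)            ≈⟨ ×-distrib-+ x y (k * l) ⟩
          (k * l) · x ∙ (k * l) · y    ≈⟨ ∙-congʳ (×-congˡ (ℕ.*-comm k l)) ⟩
          (l * k) · x ∙ (k * l) · y    ≈⟨ ∙-cong (·-annihilate l kx≈ε) (·-annihilate k ly≈ε) ⟩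
          ε ∙ ε                        ≈⟨ identityˡ ε ⟩
          ε                            ∎)
    ; ⁻¹-closed = λ {x} (k , k≢0 , kx≈ε) →
        k , k≢0 , ≈-trans (·-⁻¹ k x) (≈-trans (⁻¹-cong kx≈ε) ε⁻¹≈ε)
    }

  torsion : AbelianGroup (c ⊔ ℓ) ℓ
  torsion = subgroup isTorsion-isSubgroup

⨁ : Vector (AbelianGroup c ℓ) n → AbelianGroup c ℓ
⨁ {n = n} G = record
  { Carrier = ∀ k → G.Carrier k
  ; _≈_     = λ x y → ∀ k → G._≈_ k (x k) (y k)
  ; _∙_     = λ x y k → G._∙_ k (x k) (y k)
  ; ε       = λ k → G.ε k
  ; _⁻¹     = λ x k → G._⁻¹ k (x k)
  ; isAbelianGroup = record
    { isGroup = record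
      { isMonoid = record
        { isSemigroup = record
          { isMagma = record
            { isEquivalence = record
              { refl  = λ k → G.refl k
              ; sym   = λ x≈y k → G.sym k (x≈y k)
              ; trans = λ x≈y y≈z k → G.trans k (x≈y k) (y≈z k)
              }
            ; ∙-cong = λ x≈y u≈v k → G.∙-cong k (x≈y k) (u≈v k)
            }
          ; assoc = λ x y z k → G.assoc k (x k) (y k) (z k)
          }
        ; identity = (λ x k → G.identityˡ k (x k)) , (λ x k → G.identityʳ k (x k))
        }
      ; inverse = (λ x k → G.inverseˡ k (x k)) , (λ x k → G.inverseʳ k (x k))
      ; ⁻¹-cong = λ x≈y k → G.⁻¹-cong k (x≈y k)
      }
    ; comm = λ x y k → G.comm k (x k) (y k)
    }
  }
  where module G (k : Fin n) = AbelianGroup (G k)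

multiples-isSubgroup : ∀ m → IsSubgroup ℤ.+-0-abelianGroup (+ m ℤ.∣_)
multiples-isSubgroup m = record
  { resp      = λ { refl m∣x → m∣x }
  ; ε-closed  = ℤ.divides 0ℤ refl
  ; ∙-closed  = ℤ.∣m∣n⇒∣m+n
  ; ⁻¹-closed = ℤ.∣m⇒∣-m
  }

ℤ/_ℤ : ℕ → AbelianGroup 0ℓ 0ℓ
ℤ/ m ℤ = quotient ℤ.+-0-abelianGroup (multiples-isSubgroup m)

-- G is a finite abelian group of exponent e: it is a direct sum of finitely
-- many finite cyclic groups, the lcm of whose orders is e.
record IsFiniteOfExponent (G : AbelianGroup c ℓ) (e : ℕ) : Set (c ⊔ ℓ) where
  field
    #summands    : ℕ
    order        : Vector ℕ #summands
    order≢0      : ∀ k → NonZero (order k)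
    decompose    : G ≅ ⨁ (λ k → ℤ/ order k ℤ)
    exponent≡lcm : e ≡ foldr lcm 1 order

Matrix : ℕ → ℕ → Set
Matrix m n = Fin m → Fin n → ℤ

infixr 8 _·ᵥ_

_·ᵥ_ : Matrix m n → Vector ℤ n → Vector ℤ m
(M ·ᵥ z) i = sumℤ (λ j → M i j ℤ.* z j)

ℤ^ : ℕ → AbelianGroup 0ℓ 0ℓ
ℤ^ m = Pointwise.abelianGroup (Fin m) ℤ.+-0-abelianGroup

Image : Matrix m n → Pred (Vector ℤ m) 0ℓ
Image M x = ∃[ z ] ∀ i → x i ≡ (M ·ᵥ z) i

private
  ·ᵥ-zero : (M : Matrix m n) → ∀ i → 0ℤ ≡ (M ·ᵥ (λ _ → 0ℤ)) i
  ·ᵥ-zero {n = n} M i =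
    sym (trans (ℤΣ.sum-cong-≗ (λ j → ℤ.*-zeroʳ (M i j))) (ℤΣ.sum-replicate-zero n))

  ·ᵥ-+ : (M : Matrix m n) (y z : Vector ℤ n) →
         ∀ i → (M ·ᵥ y) i ℤ.+ (M ·ᵥ z) i ≡ (M ·ᵥ (λ j → y j ℤ.+ z j)) i
  ·ᵥ-+ M y z i = sym (trans
    (ℤΣ.sum-cong-≗ (λ j → ℤ.*-distribˡ-+ (M i j) (y j) (z j)))
    (ℤΣ.∑-distrib-+ (λ j → M i j ℤ.* y j) (λ j → M i j ℤ.* z j)))

  sum-neg : (z : Vector ℤ n) → ℤ.- sumℤ z ≡ sumℤ (λ j → ℤ.- z j)
  sum-neg {ℕ.zero}  z = refl
  sum-neg {ℕ.suc n} z = trans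
    (ℤ.neg-distrib-+ (head z) (sumℤ (tail z)))
    (cong (λ s → (ℤ.- head z) ℤ.+ s) (sum-neg (tail z)))

  ·ᵥ-neg : (M : Matrix m n) (z : Vector ℤ n) →
           ∀ i → ℤ.- (M ·ᵥ z) i ≡ (M ·ᵥ (λ j → ℤ.- z j)) i
  ·ᵥ-neg M z i = trans
    (sum-neg (λ j → M i j ℤ.* z j))
    (ℤΣ.sum-cong-≗ (λ j → ℤ.neg-distribʳ-* (M i j) (z j)))

image-isSubgroup : (M : Matrix m n) → IsSubgroup (ℤ^ m) (Image M)
image-isSubgroup M = record
  { resp      = λ x≗y → map₂ (λ x≗Mz i → trans (sym (x≗y i)) (x≗Mz i))
  ; ε-closed  = _ , ·ᵥ-zero M
  ; ∙-closed  = λ (y , x≗My) (z , x′≗Mz) →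
      _ , λ i → trans (cong₂ ℤ._+_ (x≗My i) (x′≗Mz i)) (·ᵥ-+ M y z i)
  ; ⁻¹-closed = λ (z , x≗Mz) →
      _ , λ i → trans (cong ℤ.-_ (x≗Mz i)) (·ᵥ-neg M z i)
  }

cokernel : Matrix m n → AbelianGroup 0ℓ 0ℓ
cokernel {m} M = quotient (ℤ^ m) (image-isSubgroup M)

-- A finite connected loopless multigraph, as its matrix of edge
-- multiplicities.
record Graph : Set where
  field
    order     : ℕ
    edges     : Fin order → Fin order → ℕ
    symmetric : ∀ u v → edges u v ≡ edges v u
    loopless  : ∀ v → edges v v ≡ 0
    connected : ∀ u v → Star (λ x y → edges x y ≢ 0) u v

  adjacency : Matrix order order
  adjacency u v = + edges u v

record ArithmeticalStructure (H : Graph) : Set where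
  open Graph H
  field
    d : Vector ℕ order
    r : Vector ℕ order
    r≢0            : ∀ v → NonZero (r v)
    noCommonFactor : ∀ k → (∀ v → k ∣ r v) → k ≡ 1
    balanced       : ∀ v → r v * d v ≡ sumℕ (λ u → edges v u * r u)

diag : Vector ℕ n → Matrix n n
diag d i j = if does (i ≟ j) then + d i else 0ℤ

criticalGroup : {H : Graph} → ArithmeticalStructure H → AbelianGroup 0ℓ 0ℓ
criticalGroup {H} S = torsion (cokernel λ i j → diag d i j ℤ.- adjacency i j)
  where
  open Graph H
  open ArithmeticalStructure S

-- The centre is vertex zero.
starGraph : ℕ → Graph
starGraph m = record
  { order     = ℕ.suc m
  ; edges     = edges
  ; symmetric = symmetric
  ; loopless  = λ { zero → refl ; (suc _) → refl }
  ; connected = connected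
  }
  where
  edges : Fin (ℕ.suc m) → Fin (ℕ.suc m) → ℕ
  edges zero    zero    = 0
  edges zero    (suc _) = 1
  edges (suc _) zero    = 1
  edges (suc _) (suc _) = 0

  symmetric : ∀ u v → edges u v ≡ edges v u
  symmetric zero    zero    = refl
  symmetric zero    (suc _) = refl
  symmetric (suc _) zero    = refl
  symmetric (suc _) (suc _) = refl

  connected : ∀ u v → Star (λ x y → edges x y ≢ 0) u v
  connected zero    zero    = stop
  connected zero    (suc _) = (λ ()) ◅ stop
  connected (suc _) zero    = (λ ()) ◅ stop
  connected (suc _) (suc _) = _◅_ {j = zero} (λ ()) ((λ ()) ◅ stop)

{-# OPTIONS --safe #-}
module Submission where

-- A star whose leaves have degrees ℓ₁, …, ℓₙ, D, with every ℓᵢ dividing D and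
-- ∑ 1/ℓᵢ + 1/D = 1, carries an arithmetical structure with central degree 1
-- and r = (D ; D/ℓᵢ ; 1). If b ↦ ∑ (D/ℓᵢ) bᵢ is one coordinate of an
-- isomorphism ∏ ℤ/ℓᵢ ≅ T × ℤ/D, then the critical group is T. For the given
-- pairwise coprime dᵢ and D = ∏ dᵢ, this holds with T trivial, by the Chinese
-- remainder theorem. If D = m t, then 1/D = 1/(m(t+1)) + 1/(D(t+1)), and trading
-- the leaf D for leaves m(t+1) and D(t+1) turns T into T × ℤ/m. Since D only
-- gets replaced by multiples of itself, every cyclic summand of G can be
-- adjoined in this way.

open import Algebra.Bundles using (AbelianGroup)
import Algebra.Morphism.Construct.Composition as Composition
open import Algebra.Morphism.Structures using (module GroupMorphisms)
import Algebra.Properties.CommutativeMonoid.Mult as Mult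
import Algebra.Properties.Group as GroupProperties
import Algebra.Properties.Semiring.Sum as SemiringSum
open import Data.Fin.Base using (Fin; zero; suc)
open import Data.Fin.Properties using (suc-injective)
open import Data.Integer.Base as ℤ using (ℤ; +_; 0ℤ; 1ℤ)
open import Data.Integer.Divisibility.Signed as ℤ using (divides)
open import Data.Integer.Tactic.RingSolver using (solve-∀)
import Data.Integer.Properties as ℤ
open import Data.Nat.Base as ℕ using (ℕ; NonZero; suc)
open import Data.Nat.Coprimality using (Coprime; coprime-Bézout; coprime-divisor)
open import Data.Nat.Divisibility as ℕ using (_∣_; ∣-trans; ∣-refl; n∣m*n; ∣1⇒≡1)
open import Data.Nat.GCD using (module Bézout)
open import Data.Nat.LCM using (lcm; m∣lcm[m,n]; n∣lcm[m,n])
import Data.Nat.Properties as ℕ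
import Data.Nat.Tactic.RingSolver as ℕSolver
open import Data.Product.Base using (_×_; Σ-syntax; ∃-syntax; _,_; proj₁; proj₂)
open import Data.Rational.Base using (_/_; _+_; 1ℚ; fromℚᵘ)
import Data.Rational.Properties as ℚ
open import Data.Rational.Unnormalised.Base as ℚᵘ using (mkℚᵘ; *≡*)
import Data.Rational.Unnormalised.Properties as ℚᵘ
open import Data.Vec.Functional using (Vector; foldr; head; tail; _∷_)
open import Function.Base using (_∘_)
open import Level using (Level)
open import Relation.Binary.PropositionalEquality.Core
  using (_≡_; _≢_; refl; cong; cong₂; sym; trans; subst)
open import Relation.Binary.PropositionalEquality.Properties using (module ≡-Reasoning)
open import Defs

private
  variable
    c₁ c₂ c₃ ℓ₁ ℓ₂ ℓ₃ : Level
    k n D : ℕ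

-- Isomorphisms of abelian groups.

module _ {G : AbelianGroup c₁ ℓ₁} {H : AbelianGroup c₂ ℓ₂} where
  private
    module G = AbelianGroup G
    module H = AbelianGroup H
    open GroupMorphisms G.rawGroup H.rawGroup
    open GroupProperties H.group using (identityˡ-unique; inverseˡ-unique)

  ∙-homo⇒isGroupHomomorphism :
    {f : G.Carrier → H.Carrier} →
    (∀ {x y} → x G.≈ y → f x H.≈ f y) →
    (∀ x y → f (x G.∙ y) H.≈ f x H.∙ f y) →
    IsGroupHomomorphism f
  ∙-homo⇒isGroupHomomorphism {f} f-cong ∙-homo = record
    { isMonoidHomomorphism = record
      { isMagmaHomomorphism = record
        { isRelHomomorphism = record { cong = f-cong }
        ; homo = ∙-homo
        }
      ; ε-homo = ε-homo
      }
    ; ⁻¹-homo = λ x → inverseˡ-unique (f (x G.⁻¹)) (f x)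
        (H.trans (H.sym (∙-homo _ x)) (H.trans (f-cong (G.inverseˡ x)) ε-homo))
    }
    where
    ε-homo : f G.ε H.≈ H.ε
    ε-homo = identityˡ-unique (f G.ε) (f G.ε)
      (H.trans (H.sym (∙-homo G.ε G.ε)) (f-cong (G.identityˡ G.ε)))

≅-sym : (G : AbelianGroup c₁ ℓ₁) (H : AbelianGroup c₂ ℓ₂) → G ≅ H → H ≅ G
≅-sym G H (f , iso) = g , record
  { isGroupMonomorphism = record
    { isGroupHomomorphism = ∙-homo⇒isGroupHomomorphism {G = H} {H = G}
        (λ {x} {y} x≈y → injective (H.trans (f∘g x) (H.trans x≈y (H.sym (f∘g y)))))
        (λ x y → injective (H.trans (f∘g (x H.∙ y))
          (H.sym (H.trans (∙-homo (g x) (g y)) (H.∙-cong (f∘g x) (f∘g y))))))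
    ; injective = λ {x} {y} gx≈gy →
        H.trans (H.sym (f∘g x)) (H.trans (⟦⟧-cong gx≈gy) (f∘g y))
    }
  ; surjective = λ x → f x , λ {z} z≈fx → injective (H.trans (f∘g z) z≈fx)
  }
  where
  module G = AbelianGroup G
  module H = AbelianGroup H
  open GroupMorphisms.IsGroupIsomorphism iso
  g : H.Carrier → G.Carrier
  g y = proj₁ (surjective y)
  f∘g : ∀ y → f (g y) H.≈ y
  f∘g y = proj₂ (surjective y) G.refl

≅-trans : (G : AbelianGroup c₁ ℓ₁) (H : AbelianGroup c₂ ℓ₂) (K : AbelianGroup c₃ ℓ₃) →
          G ≅ H → H ≅ K → G ≅ K
≅-trans G H K (f , f-iso) (g , g-iso) =
  g ∘ f , Composition.isGroupIsomorphism (AbelianGroup.trans K) f-iso g-iso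

-- Weighted sums of integer vectors, and divisibility.

open SemiringSum ℤ.+-*-semiring using () renaming
  (sum-cong-≗ to sumℤ-cong; *-distribˡ-sum to *-distribˡ-sumℤ)
open SemiringSum ℕ.+-*-semiring using () renaming
  (sum-cong-≗ to sumℕ-cong; *-distribˡ-sum to *-distribˡ-sumℕ)

infixl 7 _⊙_

_⊙_ : Vector ℤ n → Vector ℤ n → ℤ
w ⊙ x = sumℤ (λ i → w i ℤ.* x i)

⊙-congʳ : (w : Vector ℤ n) {x y : Vector ℤ n} → (∀ i → x i ≡ y i) → w ⊙ x ≡ w ⊙ y
⊙-congʳ w x≗y = sumℤ-cong (λ i → cong (w i ℤ.*_) (x≗y i))

⊙-distribˡ-+ : (w x y : Vector ℤ n) → w ⊙ (λ i → x i ℤ.+ y i) ≡ w ⊙ x ℤ.+ w ⊙ y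
⊙-distribˡ-+ {ℕ.zero} w x y = refl
⊙-distribˡ-+ {suc n} w x y =
  trans (cong (λ s → w zero ℤ.* (x zero ℤ.+ y zero) ℤ.+ s) (⊙-distribˡ-+ (tail w) (tail x) (tail y)))
        (rearrange (w zero) (x zero) (y zero) (tail w ⊙ tail x) (tail w ⊙ tail y))
  where
  rearrange : ∀ w x y s t → w ℤ.* (x ℤ.+ y) ℤ.+ (s ℤ.+ t) ≡ (w ℤ.* x ℤ.+ s) ℤ.+ (w ℤ.* y ℤ.+ t)
  rearrange = solve-∀

⊙-scaleʳ : ∀ c (w x : Vector ℤ n) → w ⊙ (λ i → c ℤ.* x i) ≡ c ℤ.* (w ⊙ x)
⊙-scaleʳ c w x = trans
  (sumℤ-cong (λ i → swap (w i) c (x i)))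
  (sym (*-distribˡ-sumℤ c (λ i → w i ℤ.* x i)))
  where
  swap : ∀ w c x → w ℤ.* (c ℤ.* x) ≡ c ℤ.* (w ℤ.* x)
  swap = solve-∀

⊙-scaleˡ : ∀ c (w x : Vector ℤ n) → (λ i → c ℤ.* w i) ⊙ x ≡ c ℤ.* (w ⊙ x)
⊙-scaleˡ c w x = trans
  (sumℤ-cong (λ i → ℤ.*-assoc c (w i) (x i)))
  (sym (*-distribˡ-sumℤ c (λ i → w i ℤ.* x i)))

⊙-constʳ : ∀ c (w : Vector ℤ n) → w ⊙ (λ _ → c) ≡ sumℤ w ℤ.* c
⊙-constʳ c w = sym (SemiringSum.*-distribʳ-sum ℤ.+-*-semiring c w)

⊙-distribˡ-minus : (w x y : Vector ℤ n) → w ⊙ (λ i → x i ℤ.- y i) ≡ w ⊙ x ℤ.- w ⊙ y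
⊙-distribˡ-minus w x y = trans
  (⊙-congʳ w (λ i → cong (λ z → x i ℤ.+ z) (sym (ℤ.-1*i≡-i (y i)))))
  (trans (⊙-distribˡ-+ w x _) (cong (λ z → w ⊙ x ℤ.+ z)
    (trans (⊙-scaleʳ ℤ.-1ℤ w y) (ℤ.-1*i≡-i (w ⊙ y)))))

sumℤ-pos : (e : Vector ℕ n) → sumℤ (+_ ∘ e) ≡ + sumℕ e
sumℤ-pos {ℕ.zero} e = refl
sumℤ-pos {suc n}  e = trans (cong (λ s → + e zero ℤ.+ s) (sumℤ-pos (tail e)))
                            (sym (ℤ.pos-+ (e zero) _))

sumℤ-divisible : ∀ {m} (x : Vector ℤ n) → (∀ i → m ℤ.∣ x i) → m ℤ.∣ sumℤ x
sumℤ-divisible {ℕ.zero} x m∣x = divides 0ℤ refl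
sumℤ-divisible {suc n}  x m∣x =
  ℤ.∣m∣n⇒∣m+n (m∣x zero) (sumℤ-divisible (tail x) (m∣x ∘ suc))

-- Unlike subst, these two leave the equation unevaluated: it is often a large
-- ring-solver proof.
∣-resp : ∀ {m x y} → x ≡ y → m ℤ.∣ x → m ℤ.∣ y
∣-resp x≡y (divides q x≡qm) = divides q (trans (sym x≡y) x≡qm)

∣-respˡ : ∀ {l m x} → l ≡ m → l ℤ.∣ x → m ℤ.∣ x
∣-respˡ l≡m (divides q x≡ql) = divides q (trans x≡ql (cong (q ℤ.*_) l≡m))

-- Splittings and how to extend them by one leaf.

-- A splitting says that b ↦ (functionals ·ᵥ b , cofactor ⊙ b) induces an
-- isomorphism ∏ ℤ/ℓᵢ ≅ (∏ ℤ/mⱼ) × ℤ/D, where cofactor i = D / ℓ i.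
record Splitting (ℓ : Vector ℕ n) (D : ℕ) (m : Vector ℕ k) : Set where
  field
    cofactor    : Vector ℕ n
    cofactor-*  : ∀ i → cofactor i ℕ.* ℓ i ≡ D
    functionals : Matrix k n

  weight : Vector ℤ n → ℤ
  weight b = (+_ ∘ cofactor) ⊙ b

  field
    -- Well-definedness in the functional coordinates, injectivity and surjectivity of the induced
    -- map. Well-definedness in the weight coordinate is `weight-divisible`.
    preserves  : (b : Vector ℤ n) → (∀ i → + ℓ i ℤ.∣ b i) → ∀ j → + m j ℤ.∣ (functionals ·ᵥ b) j
    detects    : (b : Vector ℤ n) → + D ℤ.∣ weight b → (∀ j → + m j ℤ.∣ (functionals ·ᵥ b) j) →
                 ∀ i → + ℓ i ℤ.∣ b i
    surjective : (y : Vector ℤ k) (z : ℤ) → ∃[ b ] (+ D ℤ.∣ weight b ℤ.- z) ×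
                 (∀ j → + m j ℤ.∣ (functionals ·ᵥ b) j ℤ.- y j)

  cofactor-*ℤ : ∀ i → + cofactor i ℤ.* + ℓ i ≡ + D
  cofactor-*ℤ i = trans (sym (ℤ.pos-* (cofactor i) (ℓ i))) (cong +_ (cofactor-* i))

  weight-multiples : (c : Vector ℤ n) → weight (λ i → + ℓ i ℤ.* c i) ≡ + D ℤ.* sumℤ c
  weight-multiples c = trans
    (sumℤ-cong (λ i → trans (sym (ℤ.*-assoc (+ cofactor i) (+ ℓ i) (c i)))
                            (cong (ℤ._* c i) (cofactor-*ℤ i))))
    (sym (*-distribˡ-sumℤ (+ D) c))

  weight-divisible : ∀ b → (∀ i → + ℓ i ℤ.∣ b i) → + D ℤ.∣ weight b
  weight-divisible b ℓ∣b = sumℤ-divisible _ λ i →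
    ∣-respˡ (cofactor-*ℤ i) (ℤ.*-monoʳ-∣ (+ cofactor i) (ℓ∣b i))

-- (y , w) ↦ (p y + q w , s y + t w) is unimodular, and it induces
-- ℤ/D × ℤ/(m₀ s) ≅ ℤ/m₀ × ℤ/(s D) for D = m₀ t.
module Glue (ℓ : Vector ℕ (suc n)) (m : Vector ℕ (suc k)) (s t : ℕ) (p q : ℤ)
            (det : + s ℤ.* q ℤ.- + t ℤ.* p ≡ 1ℤ)
            (ℓ₀≡ : head ℓ ≡ head m ℕ.* s) (D≡ : D ≡ head m ℕ.* t)
            (S : Splitting (tail ℓ) D (tail m)) where
  module S = Splitting S
  open ≡-Reasoning
  m₀ : ℕ
  m₀ = head m
  -- Here `y` is the old weight and `w` the coordinate of the new leaf: `e` encodes s y + t w, and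
  -- the first row of `M` encodes p y + q w.
  e : Vector ℕ (suc n)
  e = t ∷ (λ i → s ℕ.* S.cofactor i)
  M : Matrix (suc k) (suc n)
  M zero    = q ∷ (λ i → p ℤ.* + S.cofactor i)
  M (suc j) = 0ℤ ∷ S.functionals j

  cofactor-head : t ℕ.* ℓ zero ≡ s ℕ.* D
  cofactor-head = begin
    t ℕ.* ℓ zero        ≡⟨ cong (t ℕ.*_) ℓ₀≡ ⟩
    t ℕ.* (m₀ ℕ.* s)    ≡⟨ identity m₀ s t ⟩
    s ℕ.* (m₀ ℕ.* t)    ≡⟨ cong (s ℕ.*_) D≡ ⟨
    s ℕ.* D             ∎
    where
    identity : ∀ m s t → t ℕ.* (m ℕ.* s) ≡ s ℕ.* (m ℕ.* t)
    identity = ℕSolver.solve-∀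

  D≡ℤ : + t ℤ.* + m₀ ≡ + D
  D≡ℤ = trans (sym (ℤ.pos-* t m₀)) (cong +_ (trans (ℕ.*-comm t m₀) (sym D≡)))
  ℓ₀≡ℤ : + s ℤ.* + m₀ ≡ + ℓ zero
  ℓ₀≡ℤ = trans (sym (ℤ.pos-* s m₀)) (cong +_ (trans (ℕ.*-comm s m₀) (sym ℓ₀≡)))

  m₀∣D : + m₀ ℤ.∣ + D
  m₀∣D = divides (+ t) (sym D≡ℤ)
  m₀∣ℓ₀ : + m₀ ℤ.∣ + ℓ zero
  m₀∣ℓ₀ = divides (+ s) (sym ℓ₀≡ℤ)
  D∣sD : + D ℤ.∣ + (s ℕ.* D)
  D∣sD = divides (+ s) (ℤ.pos-* s D)
  ℓ₀∣sD : + ℓ zero ℤ.∣ + (s ℕ.* D)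
  ℓ₀∣sD = divides (+ t) (trans (cong +_ (sym cofactor-head)) (ℤ.pos-* t (ℓ zero)))

  M-head : ∀ b → (M ·ᵥ b) zero ≡ p ℤ.* S.weight (tail b) ℤ.+ q ℤ.* b zero
  M-head b = trans (ℤ.+-comm (q ℤ.* b zero) _)
    (cong (λ z → z ℤ.+ q ℤ.* b zero) (⊙-scaleˡ p (+_ ∘ S.cofactor) (tail b)))

  M-tail : ∀ b j → (M ·ᵥ b) (suc j) ≡ (S.functionals ·ᵥ tail b) j
  M-tail b j = ℤ.+-identityˡ _

  weight : ∀ b → (+_ ∘ e) ⊙ b ≡ + s ℤ.* S.weight (tail b) ℤ.+ + t ℤ.* b zero
  weight b = trans (ℤ.+-comm (+ t ℤ.* b zero) _)
    (cong (λ z → z ℤ.+ + t ℤ.* b zero) (trans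
      (sumℤ-cong (λ i → cong (ℤ._* b (suc i)) (ℤ.pos-* s (S.cofactor i))))
      (⊙-scaleˡ (+ s) (+_ ∘ S.cofactor) (tail b))))

  unimodular : ∀ x → (+ s ℤ.* q ℤ.- + t ℤ.* p) ℤ.* x ≡ x
  unimodular x = trans (cong (ℤ._* x) det) (ℤ.*-identityˡ x)

  -- Cramer's rule for a system of determinant s q - t p = 1; `invert-w` recovers the other unknown.
  invert-y : ∀ y w → q ℤ.* (+ s ℤ.* y ℤ.+ + t ℤ.* w) ℤ.- + t ℤ.* (p ℤ.* y ℤ.+ q ℤ.* w) ≡ y
  invert-y y w = trans (identity (+ s) (+ t) p q y w) (unimodular y)
    where
    identity : ∀ s t p q y w →
      q ℤ.* (s ℤ.* y ℤ.+ t ℤ.* w) ℤ.- t ℤ.* (p ℤ.* y ℤ.+ q ℤ.* w) ≡ (s ℤ.* q ℤ.- t ℤ.* p) ℤ.* y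
    identity = solve-∀

  invert-w : ∀ y w → + s ℤ.* (p ℤ.* y ℤ.+ q ℤ.* w) ℤ.- p ℤ.* (+ s ℤ.* y ℤ.+ + t ℤ.* w) ≡ w
  invert-w y w = trans (identity (+ s) (+ t) p q y w) (unimodular w)
    where
    identity : ∀ s t p q y w →
      s ℤ.* (p ℤ.* y ℤ.+ q ℤ.* w) ℤ.- p ℤ.* (s ℤ.* y ℤ.+ t ℤ.* w) ≡ (s ℤ.* q ℤ.- t ℤ.* p) ℤ.* w
    identity = solve-∀

  -- Cramer's rule expresses y and w through s y + t w, divisible by s D, and p y + q w, divisible
  -- by m₀. In the formula for y the latter is multiplied by t, and t m₀ = D; in that for w it is
  -- multiplied by s, and s m₀ = ℓ₀. Both D and ℓ₀ divide s D.
  detects : ∀ b → + (s ℕ.* D) ℤ.∣ (+_ ∘ e) ⊙ b → (∀ j → + m j ℤ.∣ (M ·ᵥ b) j) →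
            ∀ i → + ℓ i ℤ.∣ b i
  detects b sD∣ m∣ = λ { zero → ℓ₀∣w
                       ; (suc i) → S.detects (tail b) D∣y (λ j → ∣-resp (M-tail b j) (m∣ (suc j))) i }
    where
    y = S.weight (tail b)
    w = b zero
    sD∣′ = ∣-resp (weight b) sD∣
    m₀∣′ = ∣-resp (M-head b) (m∣ zero)
    D∣y : + D ℤ.∣ y
    D∣y = ∣-resp (invert-y y w) (ℤ.∣m∣n⇒∣m-n
      (ℤ.∣n⇒∣m*n q (ℤ.∣-trans D∣sD sD∣′))
      (∣-respˡ D≡ℤ (ℤ.*-monoʳ-∣ (+ t) m₀∣′)))
    ℓ₀∣w : + ℓ zero ℤ.∣ w
    ℓ₀∣w = ∣-resp (invert-w y w) (ℤ.∣m∣n⇒∣m-n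
      (∣-respˡ ℓ₀≡ℤ (ℤ.*-monoʳ-∣ (+ s) m₀∣′))
      (ℤ.∣n⇒∣m*n p (ℤ.∣-trans ℓ₀∣sD sD∣′)))

  -- The solution w = `leaf ζ z`, y = `target ζ z` of p y + q w = ζ and s y + t w = z.
  leaf target : ℤ → ℤ → ℤ
  leaf   ζ z = + s ℤ.* ζ ℤ.- p ℤ.* z
  target ζ z = q ℤ.* z ℤ.- + t ℤ.* ζ

  module _ (ζ z : ℤ) (b : Vector ℤ n) where
    private
      w = leaf ζ z
      x = target ζ z

    -- The old weight is correct only modulo D, but it enters the new weight with the factor s,
    -- which makes the error a multiple of s D.
    lift-weight : + D ℤ.∣ S.weight b ℤ.- x → + (s ℕ.* D) ℤ.∣ (+_ ∘ e) ⊙ (w ∷ b) ℤ.- z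
    lift-weight D∣ = ∣-resp eq
      (∣-respˡ (sym (ℤ.pos-* s D)) (ℤ.*-monoʳ-∣ (+ s) D∣))
      where
      identity : ∀ s t p q σ z ζ →
        s ℤ.* (σ ℤ.- (q ℤ.* z ℤ.- t ℤ.* ζ)) ≡
        (s ℤ.* σ ℤ.+ t ℤ.* (s ℤ.* ζ ℤ.- p ℤ.* z)) ℤ.- (s ℤ.* q ℤ.- t ℤ.* p) ℤ.* z
      identity = solve-∀
      eq : + s ℤ.* (S.weight b ℤ.- x) ≡ (+_ ∘ e) ⊙ (w ∷ b) ℤ.- z
      eq = trans (identity (+ s) (+ t) p q (S.weight b) z ζ)
        (cong₂ ℤ._-_ (sym (weight (w ∷ b))) (unimodular z))

    lift-head : + D ℤ.∣ S.weight b ℤ.- x → + m₀ ℤ.∣ (M ·ᵥ (w ∷ b)) zero ℤ.- ζ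
    lift-head D∣ = ∣-resp eq (ℤ.∣n⇒∣m*n p (ℤ.∣-trans m₀∣D D∣))
      where
      identity : ∀ s t p q σ z ζ →
        p ℤ.* (σ ℤ.- (q ℤ.* z ℤ.- t ℤ.* ζ)) ≡
        (p ℤ.* σ ℤ.+ q ℤ.* (s ℤ.* ζ ℤ.- p ℤ.* z)) ℤ.- (s ℤ.* q ℤ.- t ℤ.* p) ℤ.* ζ
      identity = solve-∀
      eq : p ℤ.* (S.weight b ℤ.- x) ≡ (M ·ᵥ (w ∷ b)) zero ℤ.- ζ
      eq = trans (identity (+ s) (+ t) p q (S.weight b) z ζ)
        (cong₂ ℤ._-_ (sym (M-head (w ∷ b))) (unimodular ζ))

  lift-functionals : (y : Vector ℤ (suc k)) (z : ℤ) (b : Vector ℤ n) → + D ℤ.∣ S.weight b ℤ.- target (y zero) z →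
    (∀ j → + m (suc j) ℤ.∣ (S.functionals ·ᵥ b) j ℤ.- y (suc j)) →
    ∀ j → + m j ℤ.∣ (M ·ᵥ (leaf (y zero) z ∷ b)) j ℤ.- y j
  lift-functionals y z b D∣ m∣ zero    = lift-head (y zero) z b D∣
  lift-functionals y z b D∣ m∣ (suc j) =
    ∣-resp (cong (λ x → x ℤ.- y (suc j)) (sym (M-tail (leaf (y zero) z ∷ b) j))) (m∣ j)

  surj : (y : Vector ℤ (suc k)) (z : ℤ) → ∃[ b ] (+ (s ℕ.* D) ℤ.∣ (+_ ∘ e) ⊙ b ℤ.- z) ×
         (∀ j → + m j ℤ.∣ (M ·ᵥ b) j ℤ.- y j)
  surj y z =
    let b , D∣ , m∣ = S.surjective (tail y) (target (y zero) z)
    in leaf (y zero) z ∷ b , lift-weight (y zero) z b D∣ , lift-functionals y z b D∣ m∣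

  preserves : ∀ b → (∀ i → + ℓ i ℤ.∣ b i) → ∀ j → + m j ℤ.∣ (M ·ᵥ b) j
  preserves b ℓ∣b zero    = ∣-resp (sym (M-head b)) (ℤ.∣m∣n⇒∣m+n
    (ℤ.∣n⇒∣m*n p (ℤ.∣-trans m₀∣D (S.weight-divisible (tail b) (ℓ∣b ∘ suc))))
    (ℤ.∣n⇒∣m*n q (ℤ.∣-trans m₀∣ℓ₀ (ℓ∣b zero))))
  preserves b ℓ∣b (suc j) = ∣-resp (sym (M-tail b j)) (S.preserves (tail b) (ℓ∣b ∘ suc) j)

  e-* : ∀ i → e i ℕ.* ℓ i ≡ s ℕ.* D
  e-* zero    = cofactor-head
  e-* (suc i) = trans (ℕ.*-assoc s _ _) (cong (s ℕ.*_) (S.cofactor-* i))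

  glue : Splitting ℓ (s ℕ.* D) m
  glue = record
    { cofactor    = e
    ; cofactor-*  = e-*
    ; functionals = M
    ; preserves   = preserves
    ; detects     = detects
    ; surjective  = surj
    }

open Glue using (glue)

-- A congruence modulo 1 is no condition, so any value, here 0, may be prescribed for the dropped
-- functional.
dropTrivial : {ℓ : Vector ℕ n} {m : Vector ℕ k} → Splitting ℓ D (1 ∷ m) → Splitting ℓ D m
dropTrivial S = record
  { cofactor    = S.cofactor
  ; cofactor-*  = S.cofactor-*
  ; functionals = S.functionals ∘ suc
  ; preserves   = λ b ℓ∣b → S.preserves b ℓ∣b ∘ suc
  ; detects     = λ b D∣ m∣ → S.detects b D∣ λ { zero → 1∣ _ ; (suc j) → m∣ j }
  ; surjective  = λ y z → let b , D∣ , m∣ = S.surjective (0ℤ ∷ y) z in b , D∣ , m∣ ∘ suc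
  }
  where
  module S = Splitting S
  1∣ : ∀ x → + 1 ℤ.∣ x
  1∣ x = divides x (sym (ℤ.*-identityʳ x))

-- The Chinese remainder theorem as a splitting.

coprime-*ʳ : ∀ {i j l} → Coprime i j → Coprime i l → Coprime i (j ℕ.* l)
-- A divisor x of i is coprime to j, so x ∣ j l forces x ∣ l.
coprime-*ʳ i⊥j i⊥l (x∣i , x∣jl) = i⊥l (x∣i , coprime-divisor
  (λ (y∣x , y∣j) → i⊥j (∣-trans y∣x x∣i , y∣j)) x∣jl)

coprime-product : ∀ {i} (d : Vector ℕ n) → (∀ j → Coprime i (d j)) → Coprime i (productℕ d)
coprime-product {ℕ.zero} d i⊥d (_ , x∣1) = ∣1⇒≡1 x∣1
coprime-product {suc n}  d i⊥d = coprime-*ʳ (i⊥d zero) (coprime-product (tail d) (i⊥d ∘ suc))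

pos-difference : ∀ x s y t → 1 ℕ.+ y ℕ.* t ≡ x ℕ.* s → + x ℤ.* + s ℤ.- + y ℤ.* + t ≡ 1ℤ
pos-difference x s y t 1+yt≡xs = trans
  (cong (λ z → z ℤ.- + y ℤ.* + t) (begin
    + x ℤ.* + s               ≡⟨ ℤ.pos-* x s ⟨
    + (x ℕ.* s)               ≡⟨ cong +_ 1+yt≡xs ⟨
    + (1 ℕ.+ y ℕ.* t)         ≡⟨ ℤ.pos-+ 1 (y ℕ.* t) ⟩
    1ℤ ℤ.+ + (y ℕ.* t)        ≡⟨ cong (λ z → 1ℤ ℤ.+ z) (ℤ.pos-* y t) ⟩
    1ℤ ℤ.+ + y ℤ.* + t        ∎))
  (cancel (+ y ℤ.* + t))
  where
  open ≡-Reasoning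
  cancel : ∀ a → (1ℤ ℤ.+ a) ℤ.- a ≡ 1ℤ
  cancel = solve-∀

-- Bézout's identity in ℕ has two forms, according to which side is larger; in ℤ the second becomes
-- the first by negating both coefficients.
bézoutℤ : ∀ {s t} → Coprime s t → ∃[ p ] ∃[ q ] + s ℤ.* q ℤ.- + t ℤ.* p ≡ 1ℤ
bézoutℤ {s} {t} s⊥t with coprime-Bézout s⊥t
... | Bézout.+- x y 1+yt≡xs = + y , + x ,
  trans (rearrange (+ s) (+ t) (+ x) (+ y)) (pos-difference x s y t 1+yt≡xs)
  where
  rearrange : ∀ s t x y → s ℤ.* x ℤ.- t ℤ.* y ≡ x ℤ.* s ℤ.- y ℤ.* t
  rearrange = solve-∀
... | Bézout.-+ x y 1+xs≡yt = ℤ.- (+ y) , ℤ.- (+ x) ,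
  trans (rearrange (+ s) (+ t) (+ x) (+ y)) (pos-difference y t x s 1+xs≡yt)
  where
  rearrange : ∀ s t x y → s ℤ.* (ℤ.- x) ℤ.- t ℤ.* (ℤ.- y) ≡ y ℤ.* t ℤ.- x ℤ.* s
  rearrange = solve-∀

coprimeSplitting : (d : Vector ℕ n) → (∀ i j → i ≢ j → Coprime (d i) (d j)) →
                   (m : Vector ℕ 0) → Splitting d (productℕ d) m
coprimeSplitting {ℕ.zero} d _ m = record
  { cofactor = λ () ; cofactor-* = λ () ; functionals = λ ()
  ; preserves = λ _ _ () ; detects = λ _ _ _ ()
  ; surjective = λ _ z → (λ ()) , divides (0ℤ ℤ.- z) (sym (ℤ.*-identityʳ _)) , λ ()
  }
coprimeSplitting {suc n} d coprime m =
  let p , q , det = bézoutℤ (coprime-product (tail d) λ j → coprime zero (suc j) λ ())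
  -- Gluing with m₀ = 1, s = d₀ and t the product of the other dᵢ adjoins only a summand ℤ/1.
  in dropTrivial (glue d (1 ∷ m) (head d) (productℕ (tail d)) p q det
       (sym (ℕ.*-identityˡ _)) (sym (ℕ.*-identityˡ _))
       (coprimeSplitting (tail d) (λ i j i≢j → coprime (suc i) (suc j) (i≢j ∘ suc-injective)) m))

-- Adjoining cyclic summands.

-- The equation ∑ 1/ℓᵢ + 1/D = 1 multiplied by D.
Total : {ℓ : Vector ℕ n} {m : Vector ℕ k} → Splitting ℓ D m → Set
Total {D = D} S = suc (sumℕ (Splitting.cofactor S)) ≡ D

-- 1/D = 1/(m₀(t+1)) + 1/(D(t+1)) for D = m₀ t, so the leaf D can be traded
-- for the leaves m₀(t+1) and D(t+1). The splitting is supplied for every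
-- m : Vector ℕ 0 because these vectors are functions, equal only pointwise.
adjoinSummands : {ℓ : Vector ℕ n} (S : (m : Vector ℕ 0) → Splitting ℓ D m) → (∀ m → Total (S m)) →
  (m : Vector ℕ k) → (∀ j → m j ∣ D) →
  ∃[ n′ ] Σ[ ℓ′ ∈ Vector ℕ n′ ] ∃[ D′ ] Σ[ S′ ∈ Splitting ℓ′ D′ m ] Total S′ × D ∣ D′
adjoinSummands {k = ℕ.zero} S total m m∣D = _ , _ , _ , S m , total m , ∣-refl
-- The tail is adjoined first. Since D ∣ D′, the order `head m` still divides the modulus reached.
adjoinSummands {k = suc k} S total m m∣D with adjoinSummands S total (tail m) (m∣D ∘ suc)
... | n′ , ℓ′ , D′ , S′ , total′ , D∣D′ with ∣-trans (m∣D zero) D∣D′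
...   | ℕ.divides t D′≡ =
  suc n′ , (head m ℕ.* suc t) ∷ ℓ′ , suc t ℕ.* D′ ,
  -- With s = t + 1 and p = q = 1 the determinant is (t + 1) - t.
  glue _ m (suc t) t 1ℤ 1ℤ det refl (trans D′≡ (ℕ.*-comm t (head m))) S′ ,
  total″ , ∣-trans D∣D′ (n∣m*n (suc t))
  where
  det : + suc t ℤ.* 1ℤ ℤ.- + t ℤ.* 1ℤ ≡ 1ℤ
  det = trans (cong (λ x → x ℤ.* 1ℤ ℤ.- + t ℤ.* 1ℤ) (ℤ.pos-+ 1 t)) (identity (+ t))
    where
    identity : ∀ t → (1ℤ ℤ.+ t) ℤ.* 1ℤ ℤ.- t ℤ.* 1ℤ ≡ 1ℤ
    identity = solve-∀
  e = Splitting.cofactor S′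
  total″ : suc (t ℕ.+ sumℕ (λ i → suc t ℕ.* e i)) ≡ suc t ℕ.* D′
  total″ = trans (cong (λ x → suc (t ℕ.+ x)) (sym (*-distribˡ-sumℕ (suc t) e)))
    (trans (identity t (sumℕ e)) (cong (suc t ℕ.*_) total′))
    where
    identity : ∀ t s → suc (t ℕ.+ suc t ℕ.* s) ≡ suc t ℕ.* suc s
    identity = ℕSolver.solve-∀

-- Clearing denominators in the sum of reciprocals.

fromℚᵘ-homo-+ : ∀ p q → fromℚᵘ (p ℚᵘ.+ q) ≡ fromℚᵘ p + fromℚᵘ q
fromℚᵘ-homo-+ p q = ℚ.toℚᵘ-injective (ℚᵘ.≃-trans (ℚ.toℚᵘ-fromℚᵘ (p ℚᵘ.+ q)) (ℚᵘ.≃-sym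
  (ℚᵘ.≃-trans (ℚ.toℚᵘ-homo-+ (fromℚᵘ p) (fromℚᵘ q))
              (ℚᵘ.+-cong (ℚ.toℚᵘ-fromℚᵘ p) (ℚ.toℚᵘ-fromℚᵘ q)))))

cross-multiply : ∀ {i j c d} .{{_ : NonZero c}} .{{_ : NonZero d}} →
                 i ℤ.* + d ≡ j ℤ.* + c → i / c ≡ j / d
-- Once the denominators are successors, both sides are images under `fromℚᵘ` of unreduced
-- fractions, whose equality is cross multiplication.
cross-multiply {i} {j} {suc c} {suc d} eq = ℚ.fromℚᵘ-cong {mkℚᵘ i c} {mkℚᵘ j d} (*≡* eq)

/-distribʳ-+ : ∀ d .{{_ : NonZero d}} i j → (i ℤ.+ j) / d ≡ i / d + j / d
/-distribʳ-+ (suc d) i j = trans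
  (ℚ.fromℚᵘ-cong {mkℚᵘ (i ℤ.+ j) d} {mkℚᵘ i d ℚᵘ.+ mkℚᵘ j d} (*≡*
    (trans (cong ((i ℤ.+ j) ℤ.*_) (ℤ.pos-* (suc d) (suc d))) (identity i j (+ suc d)))))
  (fromℚᵘ-homo-+ (mkℚᵘ i d) (mkℚᵘ j d))
  where
  identity : ∀ i j d → (i ℤ.+ j) ℤ.* (d ℤ.* d) ≡ (i ℤ.* d ℤ.+ j ℤ.* d) ℤ.* d
  identity = solve-∀

-- Each 1/dᵢ equals eᵢ/D, so all terms share the denominator D.
sum-of-reciprocals : .{{_ : NonZero D}} (d e : Vector ℕ n) (d≢0 : ∀ i → NonZero (d i)) →
  (∀ i → e i ℕ.* d i ≡ D) → sumℚ (λ i → (1ℤ / d i) {{d≢0 i}}) ≡ + sumℕ e / D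
sum-of-reciprocals {n = ℕ.zero} d e d≢0 ed≡D = cross-multiply {0ℤ} {0ℤ} {1} refl
sum-of-reciprocals {D = D} {n = suc n} d e d≢0 ed≡D = trans
  (cong₂ _+_
    (cross-multiply {1ℤ} {+ e zero} {{d≢0 zero}}
      (trans (ℤ.*-identityˡ (+ D)) (trans (cong +_ (sym (ed≡D zero))) (ℤ.pos-* (e zero) (d zero)))))
    (sum-of-reciprocals (tail d) (tail e) (d≢0 ∘ suc) (ed≡D ∘ suc)))
  (sym (trans (cong (_/ D) (ℤ.pos-+ (e zero) (sumℕ (tail e)))) (/-distribʳ-+ D (+ e zero) (+ sumℕ (tail e)))))

i/d≡1⇒i≡d : ∀ {i d} .{{_ : NonZero d}} → i / d ≡ 1ℚ → i ≡ + d
i/d≡1⇒i≡d {i} {suc d} i/d≡1 with ℚ.fromℚᵘ-injective {mkℚᵘ i d} {ℚᵘ.1ℚᵘ} i/d≡1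
... | *≡* eq = trans (sym (ℤ.*-identityʳ i)) (trans eq (ℤ.*-identityˡ _))

reciprocals-total : {m : Vector ℕ k} (d : Vector ℕ n) (d≢0 : ∀ i → NonZero (d i)) .{{_ : NonZero D}}
  (S : Splitting d D m) →
  sumℚ (λ i → (1ℤ / d i) {{d≢0 i}}) + 1ℤ / D ≡ 1ℚ → Total S
reciprocals-total {D = D} d d≢0 S sum≡1 = ℤ.+-injective (i/d≡1⇒i≡d
  (trans (cong (_/ D) (trans (cong +_ (ℕ.+-comm 1 (sumℕ e))) (ℤ.pos-+ (sumℕ e) 1)))
  (trans (/-distribʳ-+ D (+ sumℕ e) 1ℤ)
  (trans (cong (_+ 1ℤ / D) (sym (sum-of-reciprocals d e d≢0 (Splitting.cofactor-* S)))) sum≡1))))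
  where e = Splitting.cofactor S

-- The matrix of a star with given degrees.

Laplacian : (n : ℕ) → Vector ℕ (suc n) → Matrix (suc n) (suc n)
Laplacian n d i j = diag d i j ℤ.- Graph.adjacency (starGraph n) i j

-- The subtracted `0ℤ` is the adjacency of two leaves: this is the block of the leaf rows and leaf
-- columns.
diag-·ᵥ : (d : Vector ℕ n) (z : Vector ℤ n) → ∀ i →
          sumℤ (λ j → (diag d i j ℤ.- 0ℤ) ℤ.* z j) ≡ + d i ℤ.* z i
diag-·ᵥ {suc n} d z zero    = trans
  (cong₂ ℤ._+_ (cong (ℤ._* z zero) (ℤ.+-identityʳ (+ d zero)))
    (SemiringSum.sum-replicate-zero ℤ.+-*-semiring n))
  (ℤ.+-identityʳ _)
diag-·ᵥ {suc n} d z (suc i) = trans (ℤ.+-identityˡ _) (diag-·ᵥ (tail d) (tail z) i)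

Laplacian-centre : (d : Vector ℕ (suc n)) (z : Vector ℤ (suc n)) →
  (Laplacian n d ·ᵥ z) zero ≡ + d zero ℤ.* z zero ℤ.- sumℤ (tail z)
Laplacian-centre d z = cong₂ ℤ._+_
  (cong (ℤ._* z zero) (ℤ.+-identityʳ (+ d zero)))
  (trans (sym (*-distribˡ-sumℤ ℤ.-1ℤ (tail z))) (ℤ.-1*i≡-i (sumℤ (tail z))))

Laplacian-leaf : (d : Vector ℕ (suc n)) (z : Vector ℤ (suc n)) → ∀ i →
  (Laplacian n d ·ᵥ z) (suc i) ≡ + d (suc i) ℤ.* z (suc i) ℤ.- z zero
Laplacian-leaf d z i = trans
  (cong₂ ℤ._+_ (ℤ.-1*i≡-i (z zero)) (diag-·ᵥ (tail d) (tail z) i))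
  (ℤ.+-comm (ℤ.- z zero) _)

-- The arithmetical structure on the star and the image of its matrix.

module Star {ℓ : Vector ℕ n} {m : Vector ℕ k} (S : Splitting ℓ D m) (total : Total S) where
  open Splitting S

  -- The vertices are ordered as the centre, the leaf of degree D, and the leaves of degrees ℓᵢ.
  degree multiplicity : Vector ℕ (suc (suc n))
  degree       = 1 ∷ D ∷ ℓ
  multiplicity = D ∷ 1 ∷ cofactor

  instance
    D≢0 : NonZero D
    D≢0 = subst NonZero total _

  structure : ArithmeticalStructure (starGraph (suc n))
  structure = record
    { d              = degree
    ; r              = multiplicity
    ; r≢0            = λ { zero → D≢0 ; (suc zero) → _ ; (suc (suc i)) →
        ℕ.m*n≢0⇒m≢0 (cofactor i) {{subst NonZero (sym (cofactor-* i)) D≢0}} }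
    ; noCommonFactor = λ k k∣r → ∣1⇒≡1 (k∣r (suc zero))
    ; balanced       = λ
        { zero → trans (ℕ.*-identityʳ D) (trans (sym total)
            (cong suc (sumℕ-cong (λ i → sym (ℕ.*-identityˡ (cofactor i))))))
        ; (suc zero) → trans (ℕ.*-identityˡ D) (sym neighbours)
        ; (suc (suc i)) → trans (cofactor-* i) (sym neighbours)
        }
    }
    where
    neighbours : 1 ℕ.* D ℕ.+ sumℕ {n} (λ _ → 0) ≡ D
    neighbours = trans
      (cong₂ ℕ._+_ (ℕ.*-identityˡ D) (SemiringSum.sum-replicate-zero ℕ.+-*-semiring n))
      (ℕ.+-identityʳ D)

  L : Matrix (suc (suc n)) (suc (suc n))
  L = Laplacian (suc n) degree

  -- The column (1 , -1 , … , -1) of the centre clears the coordinate of the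
  -- leaf of degree D; these are the remaining leaf coordinates.
  shift : Vector ℤ (suc (suc n)) → Vector ℤ n
  shift x i = x (suc (suc i)) ℤ.- x (suc zero)

  -- Induces the isomorphism from the critical group to ∏ ℤ/mⱼ.
  φ : Vector ℤ (suc (suc n)) → Vector ℤ k
  φ x = functionals ·ᵥ shift x

  -- The pairing with r. It vanishes on the image of `L`, and its zeros are exactly the vectors that
  -- are torsion in the cokernel.
  rank : Vector ℤ (suc (suc n)) → ℤ
  rank x = (+_ ∘ multiplicity) ⊙ x

  D≡1+sum : + D ≡ 1ℤ ℤ.+ sumℤ (+_ ∘ cofactor)
  D≡1+sum = trans (cong +_ (sym total)) (trans (ℤ.pos-+ 1 (sumℕ cofactor))
    (cong (λ s → 1ℤ ℤ.+ s) (sym (sumℤ-pos cofactor))))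

  -- With E the sum of the cofactors, shifting removes E x₁ from the weight, and D = 1 + E by
  -- `Total`; so D x₁ - E x₁ leaves x₁, whose multiplicity is 1.
  rank-shift : ∀ x → rank x ≡ + D ℤ.* (x zero ℤ.+ x (suc zero)) ℤ.+ weight (shift x)
  rank-shift x = sym (begin
    + D ℤ.* (x₀ ℤ.+ x₁) ℤ.+ weight (shift x)
      ≡⟨ cong (λ s → + D ℤ.* (x₀ ℤ.+ x₁) ℤ.+ s) (trans
           (⊙-distribˡ-minus (+_ ∘ cofactor) (tail (tail x)) (λ _ → x₁))
           (cong (λ s → weight (tail (tail x)) ℤ.- s) (⊙-constʳ x₁ (+_ ∘ cofactor)))) ⟩
    + D ℤ.* (x₀ ℤ.+ x₁) ℤ.+ (weight (tail (tail x)) ℤ.- E ℤ.* x₁)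
      ≡⟨ cong (λ d → d ℤ.* (x₀ ℤ.+ x₁) ℤ.+ (weight (tail (tail x)) ℤ.- E ℤ.* x₁)) D≡1+sum ⟩
    (1ℤ ℤ.+ E) ℤ.* (x₀ ℤ.+ x₁) ℤ.+ (weight (tail (tail x)) ℤ.- E ℤ.* x₁)
      ≡⟨ identity E x₀ x₁ (weight (tail (tail x))) ⟩
    (1ℤ ℤ.+ E) ℤ.* x₀ ℤ.+ (1ℤ ℤ.* x₁ ℤ.+ weight (tail (tail x)))
      ≡⟨ cong (λ d → d ℤ.* x₀ ℤ.+ (1ℤ ℤ.* x₁ ℤ.+ weight (tail (tail x)))) D≡1+sum ⟨
    rank x ∎)
    where
    open ≡-Reasoning
    x₀ = x zero
    x₁ = x (suc zero)
    E = sumℤ (+_ ∘ cofactor)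
    identity : ∀ E x₀ x₁ w → (1ℤ ℤ.+ E) ℤ.* (x₀ ℤ.+ x₁) ℤ.+ (w ℤ.- E ℤ.* x₁) ≡
                             (1ℤ ℤ.+ E) ℤ.* x₀ ℤ.+ (1ℤ ℤ.* x₁ ℤ.+ w)
    identity = solve-∀

  module _ {x : Vector ℤ (suc (suc n))} (z : Vector ℤ (suc (suc n)))
           (x≗Lz : ∀ i → x i ≡ (L ·ᵥ z) i) where
    private
      z₀ = z zero
      z₁ = z (suc zero)
      z₂ : Vector ℤ n
      z₂ = tail (tail z)

      c : Vector ℤ n
      c i = z₂ i ℤ.- + cofactor i ℤ.* z₁

    -- The centre contributes -z₀ to every leaf row, so it cancels in differences of leaf
    -- coordinates.
    shift-image : ∀ i → shift x i ≡ + ℓ i ℤ.* z₂ i ℤ.- + D ℤ.* z₁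
    shift-image i = trans
      (cong₂ ℤ._-_ (trans (x≗Lz (suc (suc i))) (Laplacian-leaf degree z (suc i)))
                   (trans (x≗Lz (suc zero)) (Laplacian-leaf degree z zero)))
      (identity (+ ℓ i ℤ.* z₂ i) z₀ (+ D ℤ.* z₁))
      where
      identity : ∀ a z b → (a ℤ.- z) ℤ.- (b ℤ.- z) ≡ a ℤ.- b
      identity = solve-∀

    image⇒shift-divisible : ∀ i → + ℓ i ℤ.∣ shift x i
    image⇒shift-divisible i = divides (c i) (trans (shift-image i)
      (trans (cong (λ d → + ℓ i ℤ.* z₂ i ℤ.- d ℤ.* z₁) (sym (cofactor-*ℤ i)))
             (identity (+ ℓ i) (z₂ i) (+ cofactor i) z₁)))
      where
      identity : ∀ l z e y → l ℤ.* z ℤ.- (e ℤ.* l) ℤ.* y ≡ (z ℤ.- e ℤ.* y) ℤ.* l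
      identity = solve-∀

    image⇒rank≡0 : rank x ≡ 0ℤ
    image⇒rank≡0 = begin
      rank x
        ≡⟨ rank-shift x ⟩
      + D ℤ.* (x zero ℤ.+ x (suc zero)) ℤ.+ weight (shift x)
        ≡⟨ cong₂ (λ s t → + D ℤ.* s ℤ.+ t)
             (cong₂ ℤ._+_ (trans (x≗Lz zero) (Laplacian-centre degree z))
                          (trans (x≗Lz (suc zero)) (Laplacian-leaf degree z zero)))
             (trans (⊙-congʳ (+_ ∘ cofactor) shift-image)
               (trans (⊙-distribˡ-minus (+_ ∘ cofactor) _ _)
                 (cong₂ ℤ._-_ (weight-multiples z₂) (⊙-constʳ (+ D ℤ.* z₁) (+_ ∘ cofactor))))) ⟩
      + D ℤ.* ((1ℤ ℤ.* z₀ ℤ.- (z₁ ℤ.+ sumℤ z₂)) ℤ.+ (+ D ℤ.* z₁ ℤ.- z₀)) ℤ.+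
        (+ D ℤ.* sumℤ z₂ ℤ.- E ℤ.* (+ D ℤ.* z₁))
        ≡⟨ cong (λ d → + D ℤ.* ((1ℤ ℤ.* z₀ ℤ.- (z₁ ℤ.+ sumℤ z₂)) ℤ.+ (d ℤ.* z₁ ℤ.- z₀)) ℤ.+
             (+ D ℤ.* sumℤ z₂ ℤ.- E ℤ.* (+ D ℤ.* z₁))) D≡1+sum ⟩
      + D ℤ.* ((1ℤ ℤ.* z₀ ℤ.- (z₁ ℤ.+ sumℤ z₂)) ℤ.+ ((1ℤ ℤ.+ E) ℤ.* z₁ ℤ.- z₀)) ℤ.+
        (+ D ℤ.* sumℤ z₂ ℤ.- E ℤ.* (+ D ℤ.* z₁))
        ≡⟨ identity (+ D) E z₀ z₁ (sumℤ z₂) ⟩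
      0ℤ ∎
      where
      open ≡-Reasoning
      E = sumℤ (+_ ∘ cofactor)
      identity : ∀ D E z₀ z₁ s →
        D ℤ.* ((1ℤ ℤ.* z₀ ℤ.- (z₁ ℤ.+ s)) ℤ.+ ((1ℤ ℤ.+ E) ℤ.* z₁ ℤ.- z₀)) ℤ.+
        (D ℤ.* s ℤ.- E ℤ.* (D ℤ.* z₁)) ≡ 0ℤ
      identity = solve-∀

    image⇒φ-divisible : ∀ j → + m j ℤ.∣ φ x j
    image⇒φ-divisible = preserves (shift x) image⇒shift-divisible

  divisible⇒image : ∀ {x} → rank x ≡ 0ℤ → (∀ i → + ℓ i ℤ.∣ shift x i) → Image L x
  divisible⇒image {x} rank≡0 ℓ∣shift = z , x≗Lz
    where
    x₀ = x zero
    x₁ = x (suc zero)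

    c : Vector ℤ n
    c i = ℤ._∣_.quotient (ℓ∣shift i)

    shift≡ : ∀ i → shift x i ≡ + ℓ i ℤ.* c i
    shift≡ i = trans (ℤ._∣_.equality (ℓ∣shift i)) (ℤ.*-comm (c i) (+ ℓ i))

    -- The kernel vector r has entry 1 at the leaf of degree D, so z may be normalised to 0 there.
    -- The row of that leaf then forces -x₁ at the centre, and the other leaf rows force `c`.
    z : Vector ℤ (suc (suc n))
    z = (ℤ.- x₁) ∷ 0ℤ ∷ c

    -- Only the centre row remains: its defect times D is `rank x`.
    D*≡0 : + D ℤ.* ((x₀ ℤ.+ x₁) ℤ.+ sumℤ c) ≡ 0ℤ
    D*≡0 = trans (ℤ.*-distribˡ-+ (+ D) (x₀ ℤ.+ x₁) (sumℤ c))
      (trans (cong (λ w → + D ℤ.* (x₀ ℤ.+ x₁) ℤ.+ w)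
               (sym (trans (⊙-congʳ (+_ ∘ cofactor) shift≡) (weight-multiples c))))
             (trans (sym (rank-shift x)) rank≡0))

    x₀+x₁+sum≡0 : (x₀ ℤ.+ x₁) ℤ.+ sumℤ c ≡ 0ℤ
    x₀+x₁+sum≡0 = ℤ.*-cancelˡ-≡ (+ D) _ 0ℤ (trans D*≡0 (sym (ℤ.*-zeroʳ (+ D))))

    x≗Lz : ∀ i → x i ≡ (L ·ᵥ z) i
    x≗Lz zero = trans (identity x₀ x₁ (sumℤ c))
      (trans (cong (λ y → (1ℤ ℤ.* (ℤ.- x₁) ℤ.- (0ℤ ℤ.+ sumℤ c)) ℤ.+ y) x₀+x₁+sum≡0)
      (trans (ℤ.+-identityʳ _) (sym (Laplacian-centre degree z))))
      where
      identity : ∀ x₀ x₁ s →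
        x₀ ≡ (1ℤ ℤ.* (ℤ.- x₁) ℤ.- (0ℤ ℤ.+ s)) ℤ.+ ((x₀ ℤ.+ x₁) ℤ.+ s)
      identity = solve-∀
    x≗Lz (suc zero) = trans (identity (+ D) x₁) (sym (Laplacian-leaf degree z zero))
      where
      identity : ∀ d y → y ≡ d ℤ.* 0ℤ ℤ.- (ℤ.- y)
      identity = solve-∀
    x≗Lz (suc (suc i)) = trans (identity (x (suc (suc i))) x₁)
      (trans (cong (λ y → y ℤ.- (ℤ.- x₁)) (shift≡ i)) (sym (Laplacian-leaf degree z (suc i))))
      where
      identity : ∀ x y → x ≡ (x ℤ.- y) ℤ.- (ℤ.- y)
      identity = solve-∀

  -- When the rank is 0, `rank-shift` makes the weight of the shift equal to -D (x₀ + x₁), so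
  -- `detects` applies.
  kernel⊆image : ∀ {x} → rank x ≡ 0ℤ → (∀ j → + m j ℤ.∣ φ x j) → Image L x
  kernel⊆image {x} rank≡0 m∣φ = divisible⇒image rank≡0 (detects (shift x) D∣weight m∣φ)
    where
    x₀ = x zero
    x₁ = x (suc zero)

    D∣weight : + D ℤ.∣ weight (shift x)
    D∣weight = divides (ℤ.- (x₀ ℤ.+ x₁)) (trans
      (identity (+ D) (x₀ ℤ.+ x₁) (weight (shift x)))
      (trans (cong (λ r → r ℤ.+ (ℤ.- (x₀ ℤ.+ x₁)) ℤ.* + D) (trans (sym (rank-shift x)) rank≡0))
             (ℤ.+-identityˡ _)))
      where
      identity : ∀ d a w → w ≡ (d ℤ.* a ℤ.+ w) ℤ.+ (ℤ.- a) ℤ.* d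
      identity = solve-∀

  φ-homo-+ : ∀ x y j → φ (λ i → x i ℤ.+ y i) j ≡ φ x j ℤ.+ φ y j
  φ-homo-+ x y j = trans
    (⊙-congʳ (functionals j) (λ i →
      identity (x (suc (suc i))) (y (suc (suc i))) (x (suc zero)) (y (suc zero))))
    (⊙-distribˡ-+ (functionals j) (shift x) (shift y))
    where
    identity : ∀ a b c d → (a ℤ.+ b) ℤ.- (c ℤ.+ d) ≡ (a ℤ.- c) ℤ.+ (b ℤ.- d)
    identity = solve-∀

  φ-homo-minus : ∀ x y j → φ (λ i → x i ℤ.- y i) j ≡ φ x j ℤ.- φ y j
  φ-homo-minus x y j = trans
    (⊙-congʳ (functionals j) (λ i →
      identity (x (suc (suc i))) (y (suc (suc i))) (x (suc zero)) (y (suc zero))))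
    (⊙-distribˡ-minus (functionals j) (shift x) (shift y))
    where
    identity : ∀ a b c d → (a ℤ.- b) ℤ.- (c ℤ.- d) ≡ (a ℤ.- c) ℤ.- (b ℤ.- d)
    identity = solve-∀

  -- Torsion of the cokernel, and the isomorphism.

  C : AbelianGroup _ _
  C = cokernel L

  open Mult (AbelianGroup.commutativeMonoid C) using () renaming (_×_ to _·_)

  ·-pointwise : ∀ l x i → (l · x) i ≡ + l ℤ.* x i
  ·-pointwise ℕ.zero  x i = refl
  ·-pointwise (suc l) x i = trans (cong (λ y → x i ℤ.+ y) (·-pointwise l x i))
    (trans (identity (x i) (+ l)) (cong (ℤ._* x i) (sym (ℤ.pos-+ 1 l))))
    where
    identity : ∀ x l → x ℤ.+ l ℤ.* x ≡ (1ℤ ℤ.+ l) ℤ.* x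
    identity = solve-∀

  -- A nonzero multiple of x lies in the image and so has rank 0, and ℤ has no torsion.
  torsion⇒rank≡0 : ∀ {x} → IsTorsion C x → rank x ≡ 0ℤ
  torsion⇒rank≡0 {x} (l , l≢0 , z , lx≗Lz) =
    ℤ.*-cancelˡ-≡ (+ l) (rank x) 0ℤ {{l≢0}} (begin
      + l ℤ.* rank x            ≡⟨ ⊙-scaleʳ (+ l) (+_ ∘ multiplicity) x ⟨
      rank (λ i → + l ℤ.* x i)  ≡⟨ image⇒rank≡0 z (λ i → trans (sym (·-pointwise l x i))
                                     (trans (sym (ℤ.+-identityʳ _)) (lx≗Lz i))) ⟩
      0ℤ                        ≡⟨ ℤ.*-zeroʳ (+ l) ⟨
      + l ℤ.* 0ℤ                ∎)
    where open ≡-Reasoning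

  -- The multiplier D works: every ℓᵢ divides D, hence the shift of D x.
  rank≡0⇒torsion : ∀ {x} → rank x ≡ 0ℤ → IsTorsion C x
  rank≡0⇒torsion {x} rank≡0 =
    D , D≢0 , proj₁ Dx∈image , λ i →
      trans (ℤ.+-identityʳ _) (trans (·-pointwise D x i) (proj₂ Dx∈image i))
    where
    Dx : Vector ℤ (suc (suc n))
    Dx i = + D ℤ.* x i

    identity : ∀ e l y u → (e ℤ.* l) ℤ.* y ℤ.- (e ℤ.* l) ℤ.* u ≡ (e ℤ.* (y ℤ.- u)) ℤ.* l
    identity = solve-∀

    Dx∈image : Image L Dx
    Dx∈image = divisible⇒image
      (trans (⊙-scaleʳ (+ D) (+_ ∘ multiplicity) x)
        (trans (cong (+ D ℤ.*_) rank≡0) (ℤ.*-zeroʳ (+ D))))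
      (λ i → divides (+ cofactor i ℤ.* shift x i) (trans
        (cong (λ d → d ℤ.* x (suc (suc i)) ℤ.- d ℤ.* x (suc zero)) (sym (cofactor-*ℤ i)))
        (identity (+ cofactor i) (+ ℓ i) (x (suc (suc i))) (x (suc zero)))))

  criticalGroup≅ : criticalGroup structure ≅ ⨁ (λ j → ℤ/ m j ℤ)
  criticalGroup≅ = φ ∘ proj₁ , record
    { isGroupMonomorphism = record
      { isGroupHomomorphism = ∙-homo⇒isGroupHomomorphism
          {G = criticalGroup structure} {H = ⨁ (λ j → ℤ/ m j ℤ)}
          (λ {x} {y} → φ-cong x y)
          (λ x y j → ≡⇒∣ (m j) (φ-homo-+ (proj₁ x) (proj₁ y) j))
      ; injective = λ {x} {y} → φ-injective x y
      }
    ; surjective = λ y → preimage y , λ {x} x≈ j →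
        AbelianGroup.trans (ℤ/ m j ℤ) {φ (proj₁ x) j} {φ (proj₁ (preimage y)) j} {y j}
          (φ-cong x (preimage y) x≈ j) (φ-preimage y j)
    }
    where
    open AbelianGroup (criticalGroup structure) using () renaming (Carrier to K; _≈_ to _≈ₖ_)

    ≡⇒∣ : ∀ l {i j} → i ≡ j → + l ℤ.∣ i ℤ.- j
    ≡⇒∣ l {i} refl = divides 0ℤ (ℤ.+-inverseʳ i)

    φ-cong : (x y : K) → x ≈ₖ y → ∀ j → + m j ℤ.∣ φ (proj₁ x) j ℤ.- φ (proj₁ y) j
    φ-cong (x , _) (y , _) (z , x-y≗Lz) j =
      ∣-resp (φ-homo-minus x y j) (image⇒φ-divisible z x-y≗Lz j)

    φ-injective : (x y : K) → (∀ j → + m j ℤ.∣ φ (proj₁ x) j ℤ.- φ (proj₁ y) j) → x ≈ₖ y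
    φ-injective (x , x-torsion) (y , y-torsion) m∣ = kernel⊆image
      (trans (⊙-distribˡ-minus (+_ ∘ multiplicity) x y)
             (cong₂ ℤ._-_ (torsion⇒rank≡0 x-torsion) (torsion⇒rank≡0 y-torsion)))
      (λ j → ∣-resp (sym (φ-homo-minus x y j)) (m∣ j))

    module _ (y : Vector ℤ k) where
      solution = surjective y 0ℤ

      b : Vector ℤ n
      b = proj₁ solution

      open ℤ._∣_ (proj₁ (proj₂ solution)) renaming (quotient to a; equality to weight-b≡)

      x : Vector ℤ (suc (suc n))
      -- Since b has weight a D, the entry -a at the centre, of multiplicity D, makes the rank 0;
      -- the entry 0 makes the shift equal to b.
      x = (ℤ.- a) ∷ 0ℤ ∷ b

      rank-x≡0 : rank x ≡ 0ℤ
      rank-x≡0 = trans (identity (+ D) a (weight b))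
        (trans (cong (λ w → w ℤ.- a ℤ.* + D) weight-b≡) (ℤ.+-inverseʳ (a ℤ.* + D)))
        where
        identity : ∀ d a w → d ℤ.* (ℤ.- a) ℤ.+ (1ℤ ℤ.* 0ℤ ℤ.+ w) ≡ (w ℤ.- 0ℤ) ℤ.- a ℤ.* d
        identity = solve-∀

      preimage : K
      preimage = x , rank≡0⇒torsion rank-x≡0

      φ-preimage : ∀ j → + m j ℤ.∣ φ x j ℤ.- y j
      φ-preimage j = ∣-resp
        (cong (λ u → u ℤ.- y j) (⊙-congʳ (functionals j) (λ i → sym (ℤ.+-identityʳ (b i)))))
        (proj₂ (proj₂ solution) j)

-- Assembling the theorem.

order∣exponent : (order : Vector ℕ n) → ∀ i → order i ∣ foldr lcm 1 order
order∣exponent order zero    = m∣lcm[m,n] (order zero) _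
order∣exponent order (suc i) =
  ∣-trans (order∣exponent (tail order) i) (n∣lcm[m,n] (order zero) _)

proposition17 : ∀ {c ℓ} (G : AbelianGroup c ℓ) (e : ℕ) → IsFiniteOfExponent G e →
    ∀ (n : ℕ) (d : Fin n → ℕ) (d≢0 : ∀ i → NonZero (d i)) →
    (∀ i j → i ≢ j → Coprime (d i) (d j)) →
    sumℚ (λ i → (1ℤ / d i) {{d≢0 i}})
    + (1ℤ / productℕ d) {{productℕ-nonZero d d≢0}} ≡ 1ℚ →
    e ∣ productℕ d →
    ∃[ m ] NonZero m × Σ[ S ∈ ArithmeticalStructure (starGraph m) ] criticalGroup S ≅ G
proposition17 G e finite n d d≢0 coprime sum≡1 e∣D =
  let base = coprimeSplitting d coprime
      _ , _ , _ , S , total , _ = adjoinSummands base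
        (λ o → reciprocals-total d d≢0 {{productℕ-nonZero d d≢0}} (base o) sum≡1)
        order (λ j → ∣-trans (order∣exponent order j) (subst (_∣ productℕ d) exponent≡lcm e∣D))
  -- The leaf of degree D′ comes on top of those of the splitting, so the number of leaves is a
  -- successor.
  in _ , _ , Star.structure S total ,
     ≅-trans (criticalGroup (Star.structure S total)) ⨁ℤ/order G
       (Star.criticalGroup≅ S total) (≅-sym G ⨁ℤ/order decompose)
  where
  open IsFiniteOfExponent finite
  ⨁ℤ/order = ⨁ (λ j → ℤ/ order j ℤ)
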